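{- Let $p\ge 1$ be an integer. Then for every real number $x$, $$\sum_{n=2}^{\infty}\left(1^p+2^p+\dots+(n-1)^p\right)\frac{x^n}{n!}=\sum_{n=1}^{\infty}n^p\left(e^x-1-\frac{x}{1!}-\frac{x^2}{2!}-\dots-\frac{x^n}{n!}\right).$$ -}

module Defs where

open import Data.Integer.Base as ℤ using (+_)
open import Data.Nat.Base as ℕ using (ℕ; zero; suc; _!)
import Data.Integer.Properties as ℤP
import Data.Nat.Properties as ℕP
import Data.Nat.Coprimality as Coprimality
open import Data.Product using (∃-syntax; _×_; _,_; proj₁; proj₂)
open import Data.Rational.Base as ℚ using (ℚ; 0ℚ; 1ℚ; ½)
import Data.Rational.Properties as ℚP
import Data.Rational.Unnormalised.Base as ℚᵘ
import Data.Rational.Unnormalised.Properties as ℚᵘP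
open import Data.Rational.Solver using (module +-*-Solver)
open import Data.Sum.Base using (inj₁; inj₂)
open import Relation.Binary.PropositionalEquality using (_≡_; refl; sym; trans; cong; cong₂; subst; subst₂)
open +-*-Solver using (solve; _:+_; _:*_; _:-_; :-_; con; _:=_)

infix  4 _<_ _≈_ _⟶_
infixl 6 _+_ _-_
infixl 7 _*_ _/_ _/!_
infix  8 -_
infixr 8 _^_

Cauchy : (ℕ → ℚ) → Set
Cauchy f = ∀ ε → 0ℚ ℚ.< ε →
           ∃[ N ] (∀ m n → N ℕ.≤ m → N ℕ.≤ n → ℚ.∣ f m ℚ.- f n ∣ ℚ.< ε)

-- There are no quotients here, so equality of reals is _≈_ below, not _≡_.
record ℝ : Set where
  constructor mkℝ
  field
    seq    : ℕ → ℚ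
    cauchy : Cauchy seq

open ℝ public

_≈_ : ℝ → ℝ → Set
x ≈ y = ∀ ε → 0ℚ ℚ.< ε →
        ∃[ N ] (∀ n → N ℕ.≤ n → ℚ.∣ seq x n ℚ.- seq y n ∣ ℚ.< ε)

_<_ : ℝ → ℝ → Set
x < y = ∃[ δ ] 0ℚ ℚ.< δ ×
        ∃[ N ] (∀ n → N ℕ.≤ n → seq x n ℚ.+ δ ℚ.≤ seq y n)

module ℚ-Lemmas where

  ⅓ : ℚ
  ⅓ = + 1 ℚ./ 3

  0<⅓* : ∀ {ε} → 0ℚ ℚ.< ε → 0ℚ ℚ.< ⅓ ℚ.* ε
  0<⅓* {ε} 0<ε = subst (ℚ._< ⅓ ℚ.* ε) (ℚP.*-zeroʳ ⅓) (ℚP.*-monoʳ-<-pos ⅓ 0<ε)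

  0<½* : ∀ {ε} → 0ℚ ℚ.< ε → 0ℚ ℚ.< ½ ℚ.* ε
  0<½* {ε} 0<ε = subst (ℚ._< ½ ℚ.* ε) (ℚP.*-zeroʳ ½) (ℚP.*-monoʳ-<-pos ½ 0<ε)

  thirds : ∀ ε → ⅓ ℚ.* ε ℚ.+ ⅓ ℚ.* ε ℚ.+ ⅓ ℚ.* ε ≡ ε
  thirds = solve 1 (λ e → con ⅓ :* e :+ con ⅓ :* e :+ con ⅓ :* e := e) refl

  halves : ∀ ε → ½ ℚ.* ε ℚ.+ ½ ℚ.* ε ≡ ε
  halves = solve 1 (λ e → con ½ :* e :+ con ½ :* e := e) refl

  ∣-∣-sym : ∀ p q → ℚ.∣ p ℚ.- q ∣ ≡ ℚ.∣ q ℚ.- p ∣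
  ∣-∣-sym p q = trans (sym (ℚP.∣-p∣≡∣p∣ (p ℚ.- q)))
    (cong ℚ.∣_∣ (solve 2 (λ a b → :- (a :- b) := b :- a) refl p q))

  ∣-∣-triangle : ∀ p q r → ℚ.∣ p ℚ.- r ∣ ℚ.≤ ℚ.∣ p ℚ.- q ∣ ℚ.+ ℚ.∣ q ℚ.- r ∣
  ∣-∣-triangle p q r = subst (λ z → ℚ.∣ z ∣ ℚ.≤ ℚ.∣ p ℚ.- q ∣ ℚ.+ ℚ.∣ q ℚ.- r ∣)
    (solve 3 (λ a b c → (a :- b) :+ (b :- c) := a :- c) refl p q r)
    (ℚP.∣p+q∣≤∣p∣+∣q∣ (p ℚ.- q) (q ℚ.- r))

  fromℕℚ : ℕ → ℚ
  fromℕℚ n = + n ℚ./ 1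

  mkℚ-nat : ∀ n → fromℕℚ n ≡ ℚ.mkℚ (+ n) 0 (Coprimality.sym (Coprimality.1-coprimeTo n))
  mkℚ-nat n = ℚP.normalize-coprime (Coprimality.sym (Coprimality.1-coprimeTo n))

  fromℕℚ-mono : ∀ {m n} → m ℕ.≤ n → fromℕℚ m ℚ.≤ fromℕℚ n
  fromℕℚ-mono {m} {n} m≤n rewrite mkℚ-nat m | mkℚ-nat n =
    ℚ.*≤* (ℤP.*-monoʳ-≤-nonNeg (+ 1) (ℤ.+≤+ m≤n))

  fromℕℚ-mono-< : ∀ {m n} → m ℕ.< n → fromℕℚ m ℚ.< fromℕℚ n
  fromℕℚ-mono-< {m} {n} m<n rewrite mkℚ-nat m | mkℚ-nat n =
    ℚ.*<* (ℤP.*-monoʳ-<-pos (+ 1) (ℤ.+<+ m<n))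

  archimedean : ∀ q → ∃[ n ] (q ℚ.≤ fromℕℚ n)
  archimedean q@(ℚ.mkℚ i d _) = ℤ.∣ i ∣ , bound
    where
    i≤∣i∣ : ∀ j → j ℤ.≤ + ℤ.∣ j ∣
    i≤∣i∣ (+ n)         = ℤP.≤-refl
    i≤∣i∣ ℤ.-[1+ n ] = ℤ.-≤+
    bound : q ℚ.≤ fromℕℚ ℤ.∣ i ∣
    bound rewrite mkℚ-nat ℤ.∣ i ∣ = ℚ.*≤* (ℤP.≤-trans
      (ℤP.≤-reflexive (ℤP.*-identityʳ i))
      (ℤP.≤-trans (i≤∣i∣ i)
        (subst (+ ℤ.∣ i ∣ ℤ.≤_) (ℤP.pos-* ℤ.∣ i ∣ (suc d)) (ℤ.+≤+ (ℕP.m≤m*n ℤ.∣ i ∣ (suc d))))))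

  unitFraction-* : ∀ m n .{{_ : ℕ.NonZero m}} .{{_ : ℕ.NonZero n}} .{{_ : ℕ.NonZero (m ℕ.* n)}} →
                   + 1 ℚ./ (m ℕ.* n) ≡ (+ 1 ℚ./ m) ℚ.* (+ 1 ℚ./ n)
  unitFraction-* m@(suc _) n@(suc _) = ℚP.toℚᵘ-injective (ℚᵘP.≃-trans
    (ℚP.toℚᵘ-fromℚᵘ (+ 1 ℚᵘ./ (m ℕ.* n)))
    (ℚᵘP.≃-sym (ℚᵘP.≃-trans (ℚP.toℚᵘ-homo-* (+ 1 ℚ./ m) (+ 1 ℚ./ n))
      (ℚᵘP.*-cong (ℚP.toℚᵘ-fromℚᵘ (+ 1 ℚᵘ./ m)) (ℚP.toℚᵘ-fromℚᵘ (+ 1 ℚᵘ./ n))))))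

  fromℕℚ-inverse : ∀ n .{{_ : ℕ.NonZero n}} → fromℕℚ n ℚ.* (+ 1 ℚ./ n) ≡ 1ℚ
  fromℕℚ-inverse n@(suc n-1) = ℚP.toℚᵘ-injective (ℚᵘP.≃-trans
    (ℚP.toℚᵘ-homo-* (fromℕℚ n) (+ 1 ℚ./ n))
    (ℚᵘP.≃-trans
      (ℚᵘP.*-cong (ℚP.toℚᵘ-fromℚᵘ (+ n ℚᵘ./ 1)) (ℚP.toℚᵘ-fromℚᵘ (+ 1 ℚᵘ./ n)))
      (ℚᵘ.*≡* (cong +_ (trans (ℕP.*-identityʳ (n ℕ.* 1))
        (trans (ℕP.*-identityʳ n) (sym (trans (ℕP.+-identityʳ _) (ℕP.+-identityʳ n)))))))))

  fromℕℚ-* : ∀ m n → fromℕℚ (m ℕ.* n) ≡ fromℕℚ m ℚ.* fromℕℚ n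
  fromℕℚ-* m n = ℚP.toℚᵘ-injective (ℚᵘP.≃-trans
    (ℚP.toℚᵘ-fromℚᵘ (+ (m ℕ.* n) ℚᵘ./ 1))
    (ℚᵘP.≃-sym (ℚᵘP.≃-trans (ℚP.toℚᵘ-homo-* (fromℕℚ m) (fromℕℚ n))
      (ℚᵘP.≃-trans
        (ℚᵘP.*-cong (ℚP.toℚᵘ-fromℚᵘ (+ m ℚᵘ./ 1)) (ℚP.toℚᵘ-fromℚᵘ (+ n ℚᵘ./ 1)))
        (ℚᵘ.*≡* (cong (ℤ._* + 1) (sym (ℤP.pos-* m n))))))))

open ℚ-Lemmas

eventuallyBounded : ∀ x → ∃[ b ] ∃[ N ] (∀ n → N ℕ.≤ n → ℚ.∣ seq x n ∣ ℚ.≤ + suc b ℚ./ 1)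
eventuallyBounded x =
  let N , close = cauchy x 1ℚ (ℚP.positive⁻¹ 1ℚ)
      b , B≤b   = archimedean (1ℚ ℚ.+ ℚ.∣ seq x N ∣)
      open ℚP.≤-Reasoning
  in b , N , λ n N≤n → begin
    ℚ.∣ seq x n ∣
      ≡⟨ cong ℚ.∣_∣ (solve 2 (λ a c → a := (a :- c) :+ c) refl (seq x n) (seq x N)) ⟩
    ℚ.∣ (seq x n ℚ.- seq x N) ℚ.+ seq x N ∣
      ≤⟨ ℚP.∣p+q∣≤∣p∣+∣q∣ (seq x n ℚ.- seq x N) (seq x N) ⟩
    ℚ.∣ seq x n ℚ.- seq x N ∣ ℚ.+ ℚ.∣ seq x N ∣
      ≤⟨ ℚP.+-monoˡ-≤ ℚ.∣ seq x N ∣ (ℚP.<⇒≤ (close n N N≤n ℕP.≤-refl)) ⟩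
    1ℚ ℚ.+ ℚ.∣ seq x N ∣
      ≤⟨ B≤b ⟩
    fromℕℚ b
      ≤⟨ fromℕℚ-mono (ℕP.n≤1+n b) ⟩
    fromℕℚ (suc b) ∎

fromℚ : ℚ → ℝ
fromℚ q = mkℝ (λ _ → q) λ ε 0<ε → 0 , λ _ _ _ _ →
  subst (ℚ._< ε) (sym (cong ℚ.∣_∣ (ℚP.+-inverseʳ q))) 0<ε

fromℕ : ℕ → ℝ
fromℕ n = fromℚ (+ n ℚ./ 1)

_+_ : ℝ → ℝ → ℝ
x + y = mkℝ (λ n → seq x n ℚ.+ seq y n) λ ε 0<ε →
  let M , closeX = cauchy x (½ ℚ.* ε) (0<½* 0<ε)
      N , closeY = cauchy y (½ ℚ.* ε) (0<½* 0<ε)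
      open ℚP.≤-Reasoning
  in M ℕ.⊔ N , λ m n p q → begin-strict
    ℚ.∣ (seq x m ℚ.+ seq y m) ℚ.- (seq x n ℚ.+ seq y n) ∣
      ≡⟨ cong ℚ.∣_∣ (solve 4 (λ a b c d → (a :+ b) :- (c :+ d) := (a :- c) :+ (b :- d))
           refl (seq x m) (seq y m) (seq x n) (seq y n)) ⟩
    ℚ.∣ (seq x m ℚ.- seq x n) ℚ.+ (seq y m ℚ.- seq y n) ∣
      ≤⟨ ℚP.∣p+q∣≤∣p∣+∣q∣ (seq x m ℚ.- seq x n) (seq y m ℚ.- seq y n) ⟩
    ℚ.∣ seq x m ℚ.- seq x n ∣ ℚ.+ ℚ.∣ seq y m ℚ.- seq y n ∣
      <⟨ ℚP.+-mono-< (closeX m n (ℕP.m⊔n≤o⇒m≤o M N p) (ℕP.m⊔n≤o⇒m≤o M N q))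
                     (closeY m n (ℕP.m⊔n≤o⇒n≤o M N p) (ℕP.m⊔n≤o⇒n≤o M N q)) ⟩
    ½ ℚ.* ε ℚ.+ ½ ℚ.* ε
      ≡⟨ halves ε ⟩
    ε ∎

-_ : ℝ → ℝ
- x = mkℝ (λ n → ℚ.- seq x n) λ ε 0<ε →
  let N , close = cauchy x ε 0<ε
  in N , λ m n p q → subst (λ z → ℚ.∣ z ∣ ℚ.< ε)
       (solve 2 (λ a b → b :- a := (:- a) :- (:- b)) refl (seq x m) (seq x n))
       (close n m q p)

_-_ : ℝ → ℝ → ℝ
x - y = x + (- y)

∣_∣ : ℝ → ℝ
∣ x ∣ = mkℝ (λ n → ℚ.∣ seq x n ∣) λ ε 0<ε →
  let N , close = cauchy x ε 0<ε
  in N , λ m n p q → ℚP.≤-<-trans (reverseTriangle (seq x m) (seq x n)) (close m n p q)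
  where
  ∣p∣-∣q∣≤∣p-q∣ : ∀ p q → ℚ.∣ p ∣ ℚ.- ℚ.∣ q ∣ ℚ.≤ ℚ.∣ p ℚ.- q ∣
  ∣p∣-∣q∣≤∣p-q∣ p q = let open ℚP.≤-Reasoning in begin
    ℚ.∣ p ∣ ℚ.- ℚ.∣ q ∣
      ≡⟨ cong (λ z → ℚ.∣ z ∣ ℚ.- ℚ.∣ q ∣) (solve 2 (λ a b → a := (a :- b) :+ b) refl p q) ⟩
    ℚ.∣ (p ℚ.- q) ℚ.+ q ∣ ℚ.- ℚ.∣ q ∣
      ≤⟨ ℚP.+-monoˡ-≤ (ℚ.- ℚ.∣ q ∣) (ℚP.∣p+q∣≤∣p∣+∣q∣ (p ℚ.- q) q) ⟩
    (ℚ.∣ p ℚ.- q ∣ ℚ.+ ℚ.∣ q ∣) ℚ.- ℚ.∣ q ∣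
      ≡⟨ solve 2 (λ a b → (a :+ b) :- b := a) refl ℚ.∣ p ℚ.- q ∣ ℚ.∣ q ∣ ⟩
    ℚ.∣ p ℚ.- q ∣ ∎

  reverseTriangle : ∀ p q → ℚ.∣ ℚ.∣ p ∣ ℚ.- ℚ.∣ q ∣ ∣ ℚ.≤ ℚ.∣ p ℚ.- q ∣
  reverseTriangle p q with ℚP.∣p∣≡p∨∣p∣≡-p (ℚ.∣ p ∣ ℚ.- ℚ.∣ q ∣)
  ... | inj₁ eq = subst (ℚ._≤ ℚ.∣ p ℚ.- q ∣) (sym eq) (∣p∣-∣q∣≤∣p-q∣ p q)
  ... | inj₂ eq = subst₂ ℚ._≤_
    (sym (trans eq (solve 2 (λ a b → :- (a :- b) := b :- a) refl ℚ.∣ p ∣ ℚ.∣ q ∣)))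
    (∣-∣-sym q p) (∣p∣-∣q∣≤∣p-q∣ q p)

_*_ : ℝ → ℝ → ℝ
x * y = mkℝ (λ n → seq x n ℚ.* seq y n) λ ε 0<ε →
  let a , Na , boundX = eventuallyBounded x
      b , Nb , boundY = eventuallyBounded y
      A  = fromℕℚ (suc a)
      B  = fromℕℚ (suc b)
      A⁻¹ = + 1 ℚ./ suc a
      B⁻¹ = + 1 ℚ./ suc b
      δx = B⁻¹ ℚ.* (½ ℚ.* ε)
      δy = A⁻¹ ℚ.* (½ ℚ.* ε)
      M , closeX = cauchy x δx (scale b 0<ε)
      N , closeY = cauchy y δy (scale a 0<ε)
      P  = Na ℕ.⊔ Nb
      Q  = M ℕ.⊔ N
      open ℚP.≤-Reasoning
  in P ℕ.⊔ Q , λ m n p q →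
    let Na≤m = ℕP.m⊔n≤o⇒m≤o Na Nb (ℕP.m⊔n≤o⇒m≤o P Q p)
        Nb≤n = ℕP.m⊔n≤o⇒n≤o Na Nb (ℕP.m⊔n≤o⇒m≤o P Q q)
        M≤m  = ℕP.m⊔n≤o⇒m≤o M N (ℕP.m⊔n≤o⇒n≤o P Q p)
        N≤m  = ℕP.m⊔n≤o⇒n≤o M N (ℕP.m⊔n≤o⇒n≤o P Q p)
        M≤n  = ℕP.m⊔n≤o⇒m≤o M N (ℕP.m⊔n≤o⇒n≤o P Q q)
        N≤n  = ℕP.m⊔n≤o⇒n≤o M N (ℕP.m⊔n≤o⇒n≤o P Q q)
        dx   = seq x m ℚ.- seq x n
        dy   = seq y m ℚ.- seq y n
    in begin-strict
    ℚ.∣ seq x m ℚ.* seq y m ℚ.- seq x n ℚ.* seq y n ∣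
      ≡⟨ cong ℚ.∣_∣ (solve 4 (λ r s t u → r :* s :- t :* u := r :* (s :- u) :+ u :* (r :- t))
           refl (seq x m) (seq y m) (seq x n) (seq y n)) ⟩
    ℚ.∣ seq x m ℚ.* dy ℚ.+ seq y n ℚ.* dx ∣
      ≤⟨ ℚP.∣p+q∣≤∣p∣+∣q∣ (seq x m ℚ.* dy) (seq y n ℚ.* dx) ⟩
    ℚ.∣ seq x m ℚ.* dy ∣ ℚ.+ ℚ.∣ seq y n ℚ.* dx ∣
      ≡⟨ cong₂ ℚ._+_ (ℚP.∣p*q∣≡∣p∣*∣q∣ (seq x m) dy) (ℚP.∣p*q∣≡∣p∣*∣q∣ (seq y n) dx) ⟩
    ℚ.∣ seq x m ∣ ℚ.* ℚ.∣ dy ∣ ℚ.+ ℚ.∣ seq y n ∣ ℚ.* ℚ.∣ dx ∣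
      ≤⟨ ℚP.+-mono-≤
           (ℚP.*-monoʳ-≤-nonNeg ℚ.∣ dy ∣ {{ℚP.∣-∣-nonNeg dy}} (boundX m Na≤m))
           (ℚP.*-monoʳ-≤-nonNeg ℚ.∣ dx ∣ {{ℚP.∣-∣-nonNeg dx}} (boundY n Nb≤n)) ⟩
    A ℚ.* ℚ.∣ dy ∣ ℚ.+ B ℚ.* ℚ.∣ dx ∣
      <⟨ ℚP.+-mono-<
           (ℚP.*-monoʳ-<-pos A {{ℚP.normalize-pos (suc a) 1}} (closeY m n N≤m N≤n))
           (ℚP.*-monoʳ-<-pos B {{ℚP.normalize-pos (suc b) 1}} (closeX m n M≤m M≤n)) ⟩
    A ℚ.* δy ℚ.+ B ℚ.* δx
      ≡⟨ cong₂ ℚ._+_ (cancel a (½ ℚ.* ε)) (cancel b (½ ℚ.* ε)) ⟩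
    ½ ℚ.* ε ℚ.+ ½ ℚ.* ε
      ≡⟨ halves ε ⟩
    ε ∎
  where
  scale : ∀ k {ε} → 0ℚ ℚ.< ε → 0ℚ ℚ.< (+ 1 ℚ./ suc k) ℚ.* (½ ℚ.* ε)
  scale k {ε} 0<ε = subst (ℚ._< (+ 1 ℚ./ suc k) ℚ.* (½ ℚ.* ε)) (ℚP.*-zeroʳ (+ 1 ℚ./ suc k))
    (ℚP.*-monoʳ-<-pos (+ 1 ℚ./ suc k) {{ℚP.normalize-pos 1 (suc k)}} (0<½* 0<ε))

  cancel : ∀ k q → fromℕℚ (suc k) ℚ.* ((+ 1 ℚ./ suc k) ℚ.* q) ≡ q
  cancel k q = trans (sym (ℚP.*-assoc (fromℕℚ (suc k)) (+ 1 ℚ./ suc k) q))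
    (trans (cong (ℚ._* q) (fromℕℚ-inverse (suc k))) (ℚP.*-identityˡ q))

_^_ : ℝ → ℕ → ℝ
x ^ zero  = fromℕ 1
x ^ suc n = x * x ^ n

_/_ : ℝ → (n : ℕ) .{{_ : ℕ.NonZero n}} → ℝ
x / n = x * fromℚ (+ 1 ℚ./ n)

_/!_ : ℝ → ℕ → ℝ
x /! n = (x / (n !)) {{n ℕP.!≢0}}

∑< : ℕ → (ℕ → ℝ) → ℝ
∑< zero    f = fromℕ 0
∑< (suc n) f = ∑< n f + f n

-- Both bounds are inclusive; the sum is empty when b ℕ.< a.
sumFromTo : ℕ → ℕ → (ℕ → ℝ) → ℝ
sumFromTo a b f = ∑< (suc b ℕ.∸ a) (λ i → f (a ℕ.+ i))

infix 5 sumFromTo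
syntax sumFromTo a b (λ k → e) = ∑[ k ∈ a ⋯ b ] e

_⟶_ : (ℕ → ℝ) → ℝ → Set
a ⟶ l = ∀ ε → 0ℚ ℚ.< ε → ∃[ N ] (∀ n → N ℕ.≤ n → ∣ a n - l ∣ < fromℚ ε)

HasSumFrom : ℕ → (ℕ → ℝ) → ℝ → Set
HasSumFrom a f s = (λ N → ∑[ k ∈ a ⋯ N ] f k) ⟶ s

-- If the sequences of approximations to a n converge uniformly as n → ∞, then
-- the diagonal sequence represents the limit of a.
module Diagonal (a : ℕ → ℝ)
  (uniform : ∀ ε → 0ℚ ℚ.< ε → ∃[ N ] (∀ n j → N ℕ.≤ n → N ℕ.≤ j →
               ℚ.∣ seq (a n) j ℚ.- seq (a N) j ∣ ℚ.< ε)) where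

  limit : ℝ
  limit = mkℝ (λ n → seq (a n) n) λ ε 0<ε →
    let N , near  = uniform (⅓ ℚ.* ε) (0<⅓* 0<ε)
        M , close = cauchy (a N) (⅓ ℚ.* ε) (0<⅓* 0<ε)
        open ℚP.≤-Reasoning
    in M ℕ.⊔ N , λ m n p q →
      let N≤m = ℕP.m⊔n≤o⇒n≤o M N p
          N≤n = ℕP.m⊔n≤o⇒n≤o M N q
          u = seq (a m) m
          v = seq (a N) m
          w = seq (a N) n
          z = seq (a n) n
      in begin-strict
      ℚ.∣ u ℚ.- z ∣
        ≤⟨ ∣-∣-triangle u w z ⟩
      ℚ.∣ u ℚ.- w ∣ ℚ.+ ℚ.∣ w ℚ.- z ∣
        ≤⟨ ℚP.+-monoˡ-≤ ℚ.∣ w ℚ.- z ∣ (∣-∣-triangle u v w) ⟩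
      ℚ.∣ u ℚ.- v ∣ ℚ.+ ℚ.∣ v ℚ.- w ∣ ℚ.+ ℚ.∣ w ℚ.- z ∣
        <⟨ ℚP.+-mono-<
             (ℚP.+-mono-< (near m m N≤m N≤m)
               (close m n (ℕP.m⊔n≤o⇒m≤o M N p) (ℕP.m⊔n≤o⇒m≤o M N q)))
             (subst (ℚ._< ⅓ ℚ.* ε) (∣-∣-sym z w) (near n n N≤n N≤n)) ⟩
      ⅓ ℚ.* ε ℚ.+ ⅓ ℚ.* ε ℚ.+ ⅓ ℚ.* ε
        ≡⟨ thirds ε ⟩
      ε ∎

  converges : a ⟶ limit
  converges ε 0<ε =
    let N , near = uniform (⅓ ℚ.* ε) (0<⅓* 0<ε)
        open ℚP.≤-Reasoning
    in N , λ n N≤n → ⅓ ℚ.* ε , 0<⅓* 0<ε , N , λ j N≤j →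
      let u = seq (a n) j
          v = seq (a N) j
          w = seq (a j) j
      in begin
      ℚ.∣ u ℚ.- w ∣ ℚ.+ ⅓ ℚ.* ε
        ≤⟨ ℚP.+-monoˡ-≤ (⅓ ℚ.* ε) (∣-∣-triangle u v w) ⟩
      ℚ.∣ u ℚ.- v ∣ ℚ.+ ℚ.∣ v ℚ.- w ∣ ℚ.+ ⅓ ℚ.* ε
        ≤⟨ ℚP.+-monoˡ-≤ (⅓ ℚ.* ε) (ℚP.+-mono-≤
             (ℚP.<⇒≤ (near n j N≤n N≤j))
             (ℚP.<⇒≤ (subst (ℚ._< ⅓ ℚ.* ε) (∣-∣-sym w v) (near j j N≤j N≤j)))) ⟩
      ⅓ ℚ.* ε ℚ.+ ⅓ ℚ.* ε ℚ.+ ⅓ ℚ.* ε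
        ≡⟨ thirds ε ⟩
      ε ∎

module ExpSeries (x : ℝ) where

  term : ℕ → ℝ
  term n = (x ^ n) /! n

  partialSum : ℕ → ℝ
  partialSum N = ∑[ k ∈ 0 ⋯ N ] term k

  term-suc : ∀ n j → seq (term (suc n)) j ≡ seq (term n) j ℚ.* (seq x j ℚ.* (+ 1 ℚ./ suc n))
  term-suc n j = trans
    (cong (seq x j ℚ.* seq (x ^ n) j ℚ.*_)
      (unitFraction-* (suc n) (n !) {{_}} {{n ℕP.!≢0}} {{suc n ℕP.!≢0}}))
    (solve 4 (λ a b c d → (a :* b) :* (c :* d) := (b :* d) :* (a :* c)) refl
      (seq x j) (seq (x ^ n) j) (+ 1 ℚ./ suc n) ((+ 1 ℚ./ (n !)) {{n ℕP.!≢0}}))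

  ratio≤½ : ∀ b n j → ℚ.∣ seq x j ∣ ℚ.≤ fromℕℚ (suc b) → 2 ℕ.* suc b ℕ.≤ suc n →
            ℚ.∣ seq x j ℚ.* (+ 1 ℚ./ suc n) ∣ ℚ.≤ ½
  ratio≤½ b n j x≤B K≤ = begin
    ℚ.∣ seq x j ℚ.* r ∣
      ≡⟨ ℚP.∣p*q∣≡∣p∣*∣q∣ (seq x j) r ⟩
    ℚ.∣ seq x j ∣ ℚ.* ℚ.∣ r ∣
      ≡⟨ cong (ℚ.∣ seq x j ∣ ℚ.*_) (ℚP.0≤p⇒∣p∣≡p (ℚP.nonNegative⁻¹ r {{r≥0}})) ⟩
    ℚ.∣ seq x j ∣ ℚ.* r
      ≤⟨ ℚP.*-monoʳ-≤-nonNeg r {{r≥0}} x≤B ⟩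
    B ℚ.* r
      ≡⟨ solve 2 (λ u v → u :* v := con ½ :* (con (fromℕℚ 2) :* u) :* v) refl B r ⟩
    ½ ℚ.* (fromℕℚ 2 ℚ.* B) ℚ.* r
      ≡⟨ cong (λ z → ½ ℚ.* z ℚ.* r) (sym (fromℕℚ-* 2 (suc b))) ⟩
    ½ ℚ.* fromℕℚ (2 ℕ.* suc b) ℚ.* r
      ≤⟨ ℚP.*-monoʳ-≤-nonNeg r {{r≥0}} (ℚP.*-monoˡ-≤-nonNeg ½ (fromℕℚ-mono K≤)) ⟩
    ½ ℚ.* fromℕℚ (suc n) ℚ.* r
      ≡⟨ ℚP.*-assoc ½ (fromℕℚ (suc n)) r ⟩
    ½ ℚ.* (fromℕℚ (suc n) ℚ.* r)
      ≡⟨ cong (½ ℚ.*_) (fromℕℚ-inverse (suc n)) ⟩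
    ½ ℚ.* 1ℚ
      ≡⟨ ℚP.*-identityʳ ½ ⟩
    ½ ∎
    where
    open ℚP.≤-Reasoning
    r = + 1 ℚ./ suc n
    B = fromℕℚ (suc b)
    r≥0 : ℚ.NonNegative r
    r≥0 = ℚP.normalize-nonNeg 1 (suc n)

  module Tail (K J J′ c : ℕ)
    (ratio : ∀ n j → K ℕ.≤ suc n → J ℕ.≤ j → ℚ.∣ seq x j ℚ.* (+ 1 ℚ./ suc n) ∣ ℚ.≤ ½)
    (boundedK : ∀ j → J′ ℕ.≤ j → ℚ.∣ seq (term K) j ∣ ℚ.≤ fromℕℚ (suc c)) where

    C : ℚ
    C = fromℕℚ (suc c)

    h : ℕ → ℚ
    h zero    = C
    h (suc i) = h i ℚ.* ½

    term≤h : ∀ i j → J ℕ.≤ j → J′ ℕ.≤ j → ℚ.∣ seq (term (i ℕ.+ K)) j ∣ ℚ.≤ h i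
    term≤h zero    j p q = boundedK j q
    term≤h (suc i) j p q = begin
      ℚ.∣ seq (term (suc i ℕ.+ K)) j ∣
        ≡⟨ cong ℚ.∣_∣ (term-suc (i ℕ.+ K) j) ⟩
      ℚ.∣ t ℚ.* s ∣
        ≡⟨ ℚP.∣p*q∣≡∣p∣*∣q∣ t s ⟩
      ℚ.∣ t ∣ ℚ.* ℚ.∣ s ∣
        ≤⟨ ℚP.*-monoˡ-≤-nonNeg ℚ.∣ t ∣ {{ℚP.∣-∣-nonNeg t}}
             (ratio (i ℕ.+ K) j (ℕP.m≤n⇒m≤1+n (ℕP.m≤n+m K i)) p) ⟩
      ℚ.∣ t ∣ ℚ.* ½
        ≤⟨ ℚP.*-monoʳ-≤-nonNeg ½ (term≤h i j p q) ⟩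
      h i ℚ.* ½ ∎
      where
      open ℚP.≤-Reasoning
      t = seq (term (i ℕ.+ K)) j
      s = seq x j ℚ.* (+ 1 ℚ./ suc (i ℕ.+ K))

    h≥0 : ∀ i → 0ℚ ℚ.≤ h i
    h≥0 zero    = fromℕℚ-mono {0} {suc c} ℕ.z≤n
    h≥0 (suc i) = subst (ℚ._≤ h i ℚ.* ½) (ℚP.*-zeroˡ ½) (ℚP.*-monoʳ-≤-nonNeg ½ (h≥0 i))

    tail≤h : ∀ i m j → J ℕ.≤ j → J′ ℕ.≤ j →
      ℚ.∣ seq (partialSum (m ℕ.+ (i ℕ.+ K))) j ℚ.- seq (partialSum (i ℕ.+ K)) j ∣ ℚ.≤ h i ℚ.- h (m ℕ.+ i)
    tail≤h i zero    j p q = ℚP.≤-reflexive (trans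
      (cong ℚ.∣_∣ (ℚP.+-inverseʳ (seq (partialSum (i ℕ.+ K)) j)))
      (sym (ℚP.+-inverseʳ (h i))))
    tail≤h i (suc m) j p q = begin
      ℚ.∣ (S ℚ.+ t) ℚ.- S₀ ∣
        ≡⟨ cong ℚ.∣_∣ (solve 3 (λ a e d → (a :+ e) :- d := (a :- d) :+ e) refl S t S₀) ⟩
      ℚ.∣ (S ℚ.- S₀) ℚ.+ t ∣
        ≤⟨ ℚP.∣p+q∣≤∣p∣+∣q∣ (S ℚ.- S₀) t ⟩
      ℚ.∣ S ℚ.- S₀ ∣ ℚ.+ ℚ.∣ t ∣
        ≤⟨ ℚP.+-mono-≤ (tail≤h i m j p q)
             (subst (λ n → ℚ.∣ seq (term (suc n)) j ∣ ℚ.≤ h (suc (m ℕ.+ i)))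
               (ℕP.+-assoc m i K) (term≤h (suc (m ℕ.+ i)) j p q)) ⟩
      (h i ℚ.- h (m ℕ.+ i)) ℚ.+ h (m ℕ.+ i) ℚ.* ½
        ≡⟨ solve 2 (λ a d → (a :- d) :+ d :* con ½ := a :- d :* con ½) refl (h i) (h (m ℕ.+ i)) ⟩
      h i ℚ.- h (m ℕ.+ i) ℚ.* ½ ∎
      where
      open ℚP.≤-Reasoning
      S  = seq (partialSum (m ℕ.+ (i ℕ.+ K))) j
      S₀ = seq (partialSum (i ℕ.+ K)) j
      t  = seq (term (suc (m ℕ.+ (i ℕ.+ K)))) j

    h-bound : ∀ i → fromℕℚ (suc i) ℚ.* h i ℚ.≤ C
    h-bound zero    = ℚP.≤-reflexive (ℚP.*-identityˡ C)
    h-bound (suc i) = begin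
      fromℕℚ (2 ℕ.+ i) ℚ.* (h i ℚ.* ½)
        ≤⟨ ℚP.*-monoʳ-≤-nonNeg (h i ℚ.* ½) {{ℚ.nonNegative (h≥0 (suc i))}}
             (fromℕℚ-mono (ℕ.s≤s (ℕP.≤-trans (ℕP.m≤m+n (suc i) i)
               (ℕP.≤-reflexive (trans (sym (ℕP.+-suc i i)) (cong (i ℕ.+_) (sym (ℕP.+-identityʳ (suc i))))))))) ⟩
      fromℕℚ (2 ℕ.* suc i) ℚ.* (h i ℚ.* ½)
        ≡⟨ cong (ℚ._* (h i ℚ.* ½)) (fromℕℚ-* 2 (suc i)) ⟩
      fromℕℚ 2 ℚ.* fromℕℚ (suc i) ℚ.* (h i ℚ.* ½)
        ≡⟨ solve 2 (λ a d → con (fromℕℚ 2) :* a :* (d :* con ½) := a :* d) refl (fromℕℚ (suc i)) (h i) ⟩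
      fromℕℚ (suc i) ℚ.* h i
        ≤⟨ h-bound i ⟩
      C ∎
      where open ℚP.≤-Reasoning

    h-small : ∀ ε → 0ℚ ℚ.< ε → ∃[ i₀ ] (∀ i → i₀ ℕ.≤ i → h i ℚ.< ε)
    h-small ε 0<ε = n , λ i n≤i →
      let N = fromℕℚ (suc i)
          N>0 : ℚ.Positive N
          N>0 = ℚP.normalize-pos (suc i) 1
      in ℚP.*-cancelˡ-<-nonNeg N {{ℚP.pos⇒nonNeg N {{N>0}}}} (begin-strict
        N ℚ.* h i
          ≤⟨ h-bound i ⟩
        C
          ≡⟨ sym (trans (ℚP.*-assoc C ε⁻¹ ε)
               (trans (cong (C ℚ.*_) (ℚP.*-inverseˡ ε)) (ℚP.*-identityʳ C))) ⟩
        C ℚ.* ε⁻¹ ℚ.* ε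
          ≤⟨ ℚP.*-monoʳ-≤-nonNeg ε {{ℚP.pos⇒nonNeg ε}} Cε⁻¹≤n ⟩
        fromℕℚ n ℚ.* ε
          <⟨ ℚP.*-monoˡ-<-pos ε (fromℕℚ-mono-< (ℕ.s≤s n≤i)) ⟩
        N ℚ.* ε ∎)
      where
      open ℚP.≤-Reasoning
      instance
        ε>0 : ℚ.Positive ε
        ε>0 = ℚ.positive 0<ε
        ε≢0 : ℚ.NonZero ε
        ε≢0 = ℚP.pos⇒nonZero ε
      ε⁻¹ = ℚ.1/ ε
      n = proj₁ (archimedean (C ℚ.* ε⁻¹))
      Cε⁻¹≤n = proj₂ (archimedean (C ℚ.* ε⁻¹))

    uniform : ∀ ε → 0ℚ ℚ.< ε → ∃[ N ] (∀ n j → N ℕ.≤ n → N ℕ.≤ j →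
                ℚ.∣ seq (partialSum n) j ℚ.- seq (partialSum N) j ∣ ℚ.< ε)
    uniform ε 0<ε = i ℕ.+ K , λ n j N≤n N≤j → begin-strict
      ℚ.∣ seq (partialSum n) j ℚ.- seq (partialSum (i ℕ.+ K)) j ∣
        ≡⟨ cong (λ k → ℚ.∣ seq (partialSum k) j ℚ.- seq (partialSum (i ℕ.+ K)) j ∣)
             (sym (ℕP.m∸n+n≡m N≤n)) ⟩
      ℚ.∣ seq (partialSum (n ℕ.∸ (i ℕ.+ K) ℕ.+ (i ℕ.+ K))) j ℚ.- seq (partialSum (i ℕ.+ K)) j ∣
        ≤⟨ tail≤h i (n ℕ.∸ (i ℕ.+ K)) j
             (ℕP.≤-trans J≤N N≤j) (ℕP.≤-trans J′≤N N≤j) ⟩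
      h i ℚ.- h (n ℕ.∸ (i ℕ.+ K) ℕ.+ i)
        ≤⟨ ℚP.+-monoʳ-≤ (h i) (ℚP.neg-antimono-≤ (h≥0 (n ℕ.∸ (i ℕ.+ K) ℕ.+ i))) ⟩
      h i ℚ.+ 0ℚ
        ≡⟨ ℚP.+-identityʳ (h i) ⟩
      h i
        <⟨ proj₂ (h-small ε 0<ε) i (ℕP.m≤n⊔m (J ℕ.⊔ J′) i₀) ⟩
      ε ∎
      where
      open ℚP.≤-Reasoning
      i₀ = proj₁ (h-small ε 0<ε)
      i  = J ℕ.⊔ J′ ℕ.⊔ i₀
      JJ′≤N : J ℕ.⊔ J′ ℕ.≤ i ℕ.+ K
      JJ′≤N = ℕP.≤-trans (ℕP.m≤m⊔n (J ℕ.⊔ J′) i₀) (ℕP.m≤m+n i K)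
      J≤N  = ℕP.m⊔n≤o⇒m≤o J J′ JJ′≤N
      J′≤N = ℕP.m⊔n≤o⇒n≤o J J′ JJ′≤N

  UniformlyCauchy : Set
  UniformlyCauchy = ∀ ε → 0ℚ ℚ.< ε → ∃[ N ] (∀ n j → N ℕ.≤ n → N ℕ.≤ j →
    ℚ.∣ seq (partialSum n) j ℚ.- seq (partialSum N) j ∣ ℚ.< ε)

  -- K stays a variable here: instantiating it earlier makes Agda unfold K !.
  uniformFrom : ∀ K J →
    (∀ n j → K ℕ.≤ suc n → J ℕ.≤ j → ℚ.∣ seq x j ℚ.* (+ 1 ℚ./ suc n) ∣ ℚ.≤ ½) →
    UniformlyCauchy
  uniformFrom K J ratio =
    let c , J′ , boundedK = eventuallyBounded (term K)
    in Tail.uniform K J J′ c ratio boundedK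

  uniform : UniformlyCauchy
  uniform =
    let b , J , bounded = eventuallyBounded x
    in uniformFrom (2 ℕ.* suc b) J (λ n j K≤ J≤j → ratio≤½ b n j (bounded j J≤j) K≤)

expSeries-converges : ∀ x → ∃[ s ] HasSumFrom 0 (λ n → (x ^ n) /! n) s
expSeries-converges x = limit , converges
  where open Diagonal (ExpSeries.partialSum x) (ExpSeries.uniform x)

exp : ℝ → ℝ
exp x = proj₁ (expSeries-converges x)

{-# OPTIONS --safe #-}
-- Abel summation turns the N-th partial sum on the right into
--   ∑_{n=2}^{N} (1^p + ⋯ + (n-1)^p) x^n/n!  +  (1^p + ⋯ + N^p) (e^x − ∑_{k≤N} x^k/k!).
-- Since 1^p + ⋯ + m^p ≤ c^m for c = 2^(p+1), the terms on the left and those of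
-- the remainder are dominated by the exponential series of c |x|; so the left
-- series converges, the remainder tends to 0, and both series have the same sum.
module Submission where

open import Data.Integer.Base as ℤ using (+_)
import Data.Integer.Properties as ℤP
open import Data.Nat.Base as ℕ using (ℕ; zero; suc; _!)
import Data.Nat.Properties as ℕP
open import Data.Product using (∃-syntax; _×_; _,_)
open import Data.Rational.Base as ℚ using (ℚ; 0ℚ)
import Data.Rational.Properties as ℚP
open import Data.Rational.Solver using (module +-*-Solver)
import Data.Rational.Unnormalised.Base as ℚᵘ
import Data.Rational.Unnormalised.Properties as ℚᵘP
open import Relation.Binary.PropositionalEquality using (_≡_; refl; sym; trans; cong; cong₂; subst)
open import Defs
open ℚ-Lemmas
open +-*-Solver using (solve; _:+_; _:*_; _:-_; con; _:=_)

-- Rational arithmetic and telescoping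

fromℕℚ-+ : ∀ m n → fromℕℚ (m ℕ.+ n) ≡ fromℕℚ m ℚ.+ fromℕℚ n
fromℕℚ-+ m n = ℚP.toℚᵘ-injective (ℚᵘP.≃-trans
  (ℚP.toℚᵘ-fromℚᵘ (+ (m ℕ.+ n) ℚᵘ./ 1))
  (ℚᵘP.≃-sym (ℚᵘP.≃-trans (ℚP.toℚᵘ-homo-+ (fromℕℚ m) (fromℕℚ n))
    (ℚᵘP.≃-trans
      (ℚᵘP.+-cong (ℚP.toℚᵘ-fromℚᵘ (+ m ℚᵘ./ 1)) (ℚP.toℚᵘ-fromℚᵘ (+ n ℚᵘ./ 1)))
      (ℚᵘ.*≡* (cong (ℤ._* + 1) (cong₂ ℤ._+_ (ℤP.*-identityʳ (+ m)) (ℤP.*-identityʳ (+ n)))))))))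

fromℕℚ-^ : ∀ k p j → seq (fromℕ k ^ p) j ≡ fromℕℚ (k ℕ.^ p)
fromℕℚ-^ k zero    j = refl
fromℕℚ-^ k (suc p) j = trans (cong (fromℕℚ k ℚ.*_) (fromℕℚ-^ k p j)) (sym (fromℕℚ-* k (k ℕ.^ p)))

p≤∣p∣ : ∀ p → p ℚ.≤ ℚ.∣ p ∣
p≤∣p∣ (ℚ.mkℚ (+ _) _ _)         = ℚP.≤-refl
p≤∣p∣ p@(ℚ.mkℚ ℤ.-[1+ _ ] _ _) = ℚP.≤-trans (ℚP.<⇒≤ (ℚP.negative⁻¹ p)) (ℚP.0≤∣p∣ p)

-- The bounds on the steps are themselves increments of `B`, so under the triangle inequality they
-- telescope.
dominated-difference : ∀ (A B : ℕ → ℚ) m →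
  (∀ n → m ℕ.≤ n → ℚ.∣ A (suc n) ℚ.- A n ∣ ℚ.≤ B (suc n) ℚ.- B n) →
  ∀ {n} → m ℕ.≤ n → ℚ.∣ A n ℚ.- A m ∣ ℚ.≤ B n ℚ.- B m
dominated-difference A B m step m≤n = go (ℕP.≤⇒≤′ m≤n)
  where
  go : ∀ {n} → m ℕ.≤′ n → ℚ.∣ A n ℚ.- A m ∣ ℚ.≤ B n ℚ.- B m
  go ℕ.≤′-refl = ℚP.≤-reflexive (trans
    (cong ℚ.∣_∣ (ℚP.+-inverseʳ (A m))) (sym (ℚP.+-inverseʳ (B m))))
  go (ℕ.≤′-step {n} m≤′n) = begin
    ℚ.∣ A (suc n) ℚ.- A m ∣
      ≤⟨ ∣-∣-triangle (A (suc n)) (A n) (A m) ⟩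
    ℚ.∣ A (suc n) ℚ.- A n ∣ ℚ.+ ℚ.∣ A n ℚ.- A m ∣
      ≤⟨ ℚP.+-mono-≤ (step n (ℕP.≤′⇒≤ m≤′n)) (go m≤′n) ⟩
    (B (suc n) ℚ.- B n) ℚ.+ (B n ℚ.- B m)
      ≡⟨ solve 3 (λ a b c → (a :- b) :+ (b :- c) := a :- c) refl (B (suc n)) (B n) (B m) ⟩
    B (suc n) ℚ.- B m ∎
    where open ℚP.≤-Reasoning

-- Power sums and their exponential bound

powerSum : ℕ → ℕ → ℕ
powerSum p zero    = 0
powerSum p (suc m) = powerSum p m ℕ.+ suc m ℕ.^ p

-- The weights are approximated by constant sequences of naturals, so bounding them reduces to an
-- inequality in ℕ.
seq-powerSum : ∀ p m j → seq (∑[ k ∈ 1 ⋯ m ] (fromℕ k ^ p)) j ≡ fromℕℚ (powerSum p m)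
seq-powerSum p zero    j = refl
seq-powerSum p (suc m) j = trans
  (cong₂ ℚ._+_ (seq-powerSum p m j) (fromℕℚ-^ (suc m) p j))
  (sym (fromℕℚ-+ (powerSum p m) (suc m ℕ.^ p)))

1+m≤2^m : ∀ m → suc m ℕ.≤ 2 ℕ.^ m
1+m≤2^m zero    = ℕP.≤-refl
1+m≤2^m (suc m) = begin
  suc (suc m)                 ≤⟨ ℕ.s≤s (1+m≤2^m m) ⟩
  1 ℕ.+ 2 ℕ.^ m               ≤⟨ ℕP.+-monoˡ-≤ (2 ℕ.^ m) (ℕP.m^n>0 2 m) ⟩
  2 ℕ.^ m ℕ.+ 2 ℕ.^ m         ≡⟨ cong (2 ℕ.^ m ℕ.+_) (sym (ℕP.+-identityʳ (2 ℕ.^ m))) ⟩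
  2 ℕ.^ suc m                 ∎
  where open ℕP.≤-Reasoning

-- Since `suc m` ≤ 2^m, the new summand is at most 2^(mp) ≤ c^m. The sum thus at most doubles the
-- bound c^m, and 2 ≤ c.
powerSum≤ : ∀ p m → powerSum p m ℕ.≤ (2 ℕ.^ suc p) ℕ.^ m
powerSum≤ p zero    = ℕ.z≤n
powerSum≤ p (suc m) = begin
  powerSum p m ℕ.+ suc m ℕ.^ p   ≤⟨ ℕP.+-mono-≤ (powerSum≤ p m) 1+m^p≤ ⟩
  c ℕ.^ m ℕ.+ c ℕ.^ m            ≡⟨ cong (c ℕ.^ m ℕ.+_) (sym (ℕP.+-identityʳ (c ℕ.^ m))) ⟩
  2 ℕ.* c ℕ.^ m                  ≤⟨ ℕP.*-monoˡ-≤ (c ℕ.^ m) (ℕP.^-monoʳ-≤ 2 {1} {suc p} (ℕ.s≤s ℕ.z≤n)) ⟩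
  c ℕ.^ suc m                    ∎
  where
  open ℕP.≤-Reasoning
  c = 2 ℕ.^ suc p
  1+m^p≤ : suc m ℕ.^ p ℕ.≤ c ℕ.^ m
  1+m^p≤ = begin
    suc m ℕ.^ p           ≤⟨ ℕP.^-monoˡ-≤ p (1+m≤2^m m) ⟩
    (2 ℕ.^ m) ℕ.^ p       ≡⟨ ℕP.^-*-assoc 2 m p ⟩
    2 ℕ.^ (m ℕ.* p)       ≤⟨ ℕP.^-monoʳ-≤ 2 (ℕP.*-monoʳ-≤ m (ℕP.n≤1+n p)) ⟩
    2 ℕ.^ (m ℕ.* suc p)   ≡⟨ cong (2 ℕ.^_) (ℕP.*-comm m (suc p)) ⟩
    2 ℕ.^ (suc p ℕ.* m)   ≡⟨ sym (ℕP.^-*-assoc 2 (suc p) m) ⟩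
    c ℕ.^ m               ∎

-- Domination by terms of an exponential series

*-interchange : ∀ a b c d → (a ℚ.* b) ℚ.* (c ℚ.* d) ≡ (a ℚ.* c) ℚ.* (b ℚ.* d)
*-interchange = solve 4 (λ a b c d → (a :* b) :* (c :* d) := (a :* c) :* (b :* d)) refl

*-abs-^ : ∀ y x n j → seq ((y * ∣ x ∣) ^ n) j ≡ seq (y ^ n) j ℚ.* ℚ.∣ seq (x ^ n) j ∣
*-abs-^ y x zero    j = refl
*-abs-^ y x (suc n) j = trans
  (cong ((seq y j ℚ.* ℚ.∣ seq x j ∣) ℚ.*_) (*-abs-^ y x n j))
  (trans
    (*-interchange (seq y j) ℚ.∣ seq x j ∣ (seq (y ^ n) j) ℚ.∣ seq (x ^ n) j ∣)
    (cong (seq (y ^ suc n) j ℚ.*_) (sym (ℚP.∣p*q∣≡∣p∣*∣q∣ (seq x j) (seq (x ^ n) j)))))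

-- A weight of at most c^n can be absorbed into the n-th power: c^n |x^n| is the n-th power of c|x|,
-- at every approximation index `j`.
weighted-term≤ : ∀ c x w n j → w ℕ.≤ c ℕ.^ n →
  ℚ.∣ fromℕℚ w ℚ.* seq (ExpSeries.term x n) j ∣ ℚ.≤ seq (ExpSeries.term (fromℕ c * ∣ x ∣) n) j
weighted-term≤ c x w n j w≤ = begin
  ℚ.∣ fromℕℚ w ℚ.* (v ℚ.* r) ∣
    ≡⟨ ℚP.∣p*q∣≡∣p∣*∣q∣ (fromℕℚ w) (v ℚ.* r) ⟩
  ℚ.∣ fromℕℚ w ∣ ℚ.* ℚ.∣ v ℚ.* r ∣
    ≡⟨ cong (ℚ._* ℚ.∣ v ℚ.* r ∣) (ℚP.0≤p⇒∣p∣≡p (fromℕℚ-mono {0} {w} ℕ.z≤n)) ⟩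
  fromℕℚ w ℚ.* ℚ.∣ v ℚ.* r ∣
    ≤⟨ ℚP.*-monoʳ-≤-nonNeg ℚ.∣ v ℚ.* r ∣ {{ℚP.∣-∣-nonNeg (v ℚ.* r)}} (fromℕℚ-mono w≤) ⟩
  Cⁿ ℚ.* ℚ.∣ v ℚ.* r ∣
    ≡⟨ cong (Cⁿ ℚ.*_) (ℚP.∣p*q∣≡∣p∣*∣q∣ v r) ⟩
  Cⁿ ℚ.* (ℚ.∣ v ∣ ℚ.* ℚ.∣ r ∣)
    ≡⟨ cong (λ q → Cⁿ ℚ.* (ℚ.∣ v ∣ ℚ.* q)) (ℚP.0≤p⇒∣p∣≡p (ℚP.nonNegative⁻¹ r {{ℚP.normalize-nonNeg 1 (n !) {{n ℕP.!≢0}}}})) ⟩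
  Cⁿ ℚ.* (ℚ.∣ v ∣ ℚ.* r)
    ≡⟨ sym (ℚP.*-assoc Cⁿ ℚ.∣ v ∣ r) ⟩
  Cⁿ ℚ.* ℚ.∣ v ∣ ℚ.* r
    ≡⟨ cong (ℚ._* r) (sym (trans (*-abs-^ (fromℕ c) x n j) (cong (ℚ._* ℚ.∣ v ∣) (fromℕℚ-^ c n j)))) ⟩
  seq (ExpSeries.term (fromℕ c * ∣ x ∣) n) j ∎
  where
  open ℚP.≤-Reasoning
  v  = seq (x ^ n) j
  r  = (+ 1 ℚ./ (n !)) {{n ℕP.!≢0}}
  Cⁿ = fromℕℚ (c ℕ.^ n)

-- The two series for fixed `p` and `x`

module _ (p : ℕ) (x : ℝ) where

  open ExpSeries x using (term; partialSum)

  realPowerSum : ℕ → ℝ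
  realPowerSum m = ∑[ k ∈ 1 ⋯ m ] (fromℕ k ^ p)

  -- The summands repeat those of the theorem verbatim: naming them by realPowerSum
  -- and term would make Agda compare the two forms by unfolding rational arithmetic.
  leftSum : ℕ → ℝ
  leftSum N = ∑[ n ∈ 2 ⋯ N ] ((∑[ k ∈ 1 ⋯ n ℕ.∸ 1 ] (fromℕ k ^ p)) * ((x ^ n) /! n))

  rightSum : ℝ → ℕ → ℝ
  rightSum e N = ∑[ n ∈ 1 ⋯ N ] ((fromℕ n ^ p) * (e - (∑[ k ∈ 0 ⋯ n ] ((x ^ k) /! k))))

  c : ℕ
  c = 2 ℕ.^ suc p

  majorant : ℕ → ℝ
  majorant = ExpSeries.partialSum (fromℕ c * ∣ x ∣)

  leftSum-suc : ∀ N j → seq (leftSum (suc N)) j ≡ seq (leftSum N) j ℚ.+ seq (realPowerSum N) j ℚ.* seq (term (suc N)) j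
  -- Both left sums are empty here, as summation starts at 2; the extra term vanishes because the
  -- weight is the empty power sum.
  leftSum-suc zero    j = sym (trans (ℚP.+-identityˡ _) (ℚP.*-zeroˡ (seq (term 1) j)))
  leftSum-suc (suc N) j = refl

  abel-summation : ∀ e N j → seq (rightSum e N) j ≡
    seq (leftSum N) j ℚ.+ seq (realPowerSum N) j ℚ.* (seq e j ℚ.- seq (partialSum N) j)
  abel-summation e zero    j = sym (trans (ℚP.+-identityˡ _) (ℚP.*-zeroˡ (seq e j ℚ.- seq (partialSum 0) j)))
  abel-summation e (suc N) j = trans
    (cong (ℚ._+ q ℚ.* (E ℚ.- (S ℚ.+ t))) (abel-summation e N j))
    (trans
      -- The old tail `E :- S` is `t` plus the new tail: `v :* t` is the next term on the left, and
      -- the new tail collects the weight `v :+ q`.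
      (solve 6 (λ l v E S q t →
         (l :+ v :* (E :- S)) :+ q :* (E :- (S :+ t)) :=
         (l :+ v :* t) :+ (v :+ q) :* (E :- (S :+ t))) refl
         (seq (leftSum N) j) (seq (realPowerSum N) j) E S q t)
      (cong (ℚ._+ (seq (realPowerSum N) j ℚ.+ q) ℚ.* (E ℚ.- (S ℚ.+ t))) (sym (leftSum-suc N j))))
    where
    E = seq e j
    S = seq (partialSum N) j
    q = seq (fromℕ (suc N) ^ p) j
    t = seq (term (suc N)) j

  -- Allowing `N` below `n` serves two purposes: `N` equal to `n` gives the increments of `leftSum`,
  -- and a fixed `N` gives those of the remainder.
  realPowerSum-term≤ : ∀ N n j → N ℕ.≤ n →
    ℚ.∣ seq (realPowerSum N) j ℚ.* seq (term (suc n)) j ∣ ℚ.≤ seq (majorant (suc n)) j ℚ.- seq (majorant n) j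
  realPowerSum-term≤ N n j N≤n = begin
    ℚ.∣ seq (realPowerSum N) j ℚ.* t ∣
      ≡⟨ cong (λ v → ℚ.∣ v ℚ.* t ∣) (seq-powerSum p N j) ⟩
    ℚ.∣ fromℕℚ (powerSum p N) ℚ.* t ∣
      ≤⟨ weighted-term≤ c x (powerSum p N) (suc n) j (ℕP.≤-trans (powerSum≤ p N)
           (ℕP.^-monoʳ-≤ c {{ℕP.m^n≢0 2 (suc p)}} (ℕP.m≤n⇒m≤1+n N≤n))) ⟩
    b
      ≡⟨ solve 2 (λ m b → b := (m :+ b) :- m) refl (seq (majorant n) j) b ⟩
    seq (majorant (suc n)) j ℚ.- seq (majorant n) j ∎
    where
    open ℚP.≤-Reasoning
    t = seq (term (suc n)) j
    b = seq (ExpSeries.term (fromℕ c * ∣ x ∣) (suc n)) j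

  leftSum-difference≤ : ∀ {m n} j → m ℕ.≤ n →
    ℚ.∣ seq (leftSum n) j ℚ.- seq (leftSum m) j ∣ ℚ.≤ seq (majorant n) j ℚ.- seq (majorant m) j
  leftSum-difference≤ {m} j = dominated-difference (λ n → seq (leftSum n) j) (λ n → seq (majorant n) j) m
    λ n _ → subst (λ z → ℚ.∣ z ∣ ℚ.≤ seq (majorant (suc n)) j ℚ.- seq (majorant n) j)
      (sym (trans (cong (ℚ._- seq (leftSum n) j) (leftSum-suc n j))
        (solve 2 (λ l d → (l :+ d) :- l := d) refl
          (seq (leftSum n) j) (seq (realPowerSum n) j ℚ.* seq (term (suc n)) j))))
      (realPowerSum-term≤ n n j ℕP.≤-refl)

  -- With the weight frozen at `m`, the multiples of the partial sums by it form a sequence in `n`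
  -- whose increments the majorant dominates.
  remainder≤ : ∀ {m n} j → m ℕ.≤ n →
    ℚ.∣ seq (realPowerSum m) j ℚ.* (seq (partialSum n) j ℚ.- seq (partialSum m) j) ∣ ℚ.≤
    seq (majorant n) j ℚ.- seq (majorant m) j
  remainder≤ {m} {n} j m≤n = subst (λ z → ℚ.∣ z ∣ ℚ.≤ seq (majorant n) j ℚ.- seq (majorant m) j)
    (solve 3 (λ v s u → v :* s :- v :* u := v :* (s :- u)) refl
      v (seq (partialSum n) j) (seq (partialSum m) j))
    (dominated-difference (λ n → v ℚ.* seq (partialSum n) j) (λ n → seq (majorant n) j) m
      (λ n m≤n → subst (λ z → ℚ.∣ z ∣ ℚ.≤ seq (majorant (suc n)) j ℚ.- seq (majorant n) j)
        (solve 3 (λ v s t → v :* t := v :* (s :+ t) :- v :* s) refl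
          v (seq (partialSum n) j) (seq (term (suc n)) j))
        (realPowerSum-term≤ m n j m≤n))
      m≤n)
    where v = seq (realPowerSum m) j

  -- Convergence of both series to one limit

  leftSum-uniform : ∀ ε → 0ℚ ℚ.< ε → ∃[ N ] (∀ n j → N ℕ.≤ n → N ℕ.≤ j →
    ℚ.∣ seq (leftSum n) j ℚ.- seq (leftSum N) j ∣ ℚ.< ε)
  leftSum-uniform ε 0<ε =
    -- The majorant is Cauchy uniformly in the approximation index `j`, and domination at each `j`
    -- passes this on to `leftSum`.
    let N , near = ExpSeries.uniform (fromℕ c * ∣ x ∣) ε 0<ε
    in N , λ n j N≤n N≤j → ℚP.≤-<-trans (leftSum-difference≤ j N≤n)
         (ℚP.≤-<-trans (p≤∣p∣ _) (near n j N≤n N≤j))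

  open Diagonal leftSum leftSum-uniform public
    renaming (limit to leftLimit; converges to leftSum-converges)

  -- Uniformity only compares with the fixed index `N`, so two comparisons, each within half of `ε`,
  -- are joined there. The diagonal index `j` is the one at which limits are read off.
  majorant-tail : ∀ ε → 0ℚ ℚ.< ε → ∃[ N ] (∀ n j → N ℕ.≤ n → n ℕ.≤ j →
    seq (majorant j) j ℚ.- seq (majorant n) j ℚ.< ε)
  majorant-tail ε 0<ε =
    let N , near = ExpSeries.uniform (fromℕ c * ∣ x ∣) (ℚ.½ ℚ.* ε) (0<½* 0<ε)
        open ℚP.≤-Reasoning
    in N , λ n j N≤n n≤j →
      let N≤j = ℕP.≤-trans N≤n n≤j
          u = seq (majorant j) j
          v = seq (majorant N) j
          w = seq (majorant n) j
      in begin-strict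
      u ℚ.- w
        ≤⟨ p≤∣p∣ (u ℚ.- w) ⟩
      ℚ.∣ u ℚ.- w ∣
        ≤⟨ ∣-∣-triangle u v w ⟩
      ℚ.∣ u ℚ.- v ∣ ℚ.+ ℚ.∣ v ℚ.- w ∣
        <⟨ ℚP.+-mono-< (near j j N≤j N≤j)
             (subst (ℚ._< ℚ.½ ℚ.* ε) (∣-∣-sym w v) (near n j N≤n N≤j)) ⟩
      ℚ.½ ℚ.* ε ℚ.+ ℚ.½ ℚ.* ε
        ≡⟨ halves ε ⟩
      ε ∎

  rightSum-converges : rightSum (exp x) ⟶ leftLimit
  rightSum-converges ε 0<ε =
    let N , small = majorant-tail (⅓ ℚ.* ε) (0<⅓* 0<ε)
        open ℚP.≤-Reasoning
    -- One third of `ε` is the slack required by strict inequality of reals; the others bound the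
    -- remainder and the left tail. Starting at `n` ensures `n` ≤ `j`, as both bounds need.
    in N , λ n N≤n → ⅓ ℚ.* ε , 0<⅓* 0<ε , n , λ j n≤j →
      let l = seq (leftSum n) j
          d = seq (leftSum j) j
          -- `exp x` is a diagonal limit, so its `j`-th approximation is that of `partialSum j`: the
          -- infinite tail becomes a finite difference.
          r = seq (realPowerSum n) j ℚ.* (seq (partialSum j) j ℚ.- seq (partialSum n) j)
          δ = ⅓ ℚ.* ε
      in begin
      ℚ.∣ seq (rightSum (exp x) n) j ℚ.- d ∣ ℚ.+ δ
        ≡⟨ cong (λ z → ℚ.∣ z ℚ.- d ∣ ℚ.+ δ) (abel-summation (exp x) n j) ⟩
      ℚ.∣ (l ℚ.+ r) ℚ.- d ∣ ℚ.+ δ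
        ≡⟨ cong (λ z → ℚ.∣ z ∣ ℚ.+ δ)
             (solve 3 (λ l r d → (l :+ r) :- d := r :+ (l :- d)) refl l r d) ⟩
      ℚ.∣ r ℚ.+ (l ℚ.- d) ∣ ℚ.+ δ
        ≤⟨ ℚP.+-monoˡ-≤ δ (ℚP.∣p+q∣≤∣p∣+∣q∣ r (l ℚ.- d)) ⟩
      ℚ.∣ r ∣ ℚ.+ ℚ.∣ l ℚ.- d ∣ ℚ.+ δ
        ≡⟨ cong (λ z → ℚ.∣ r ∣ ℚ.+ z ℚ.+ δ) (∣-∣-sym l d) ⟩
      ℚ.∣ r ∣ ℚ.+ ℚ.∣ d ℚ.- l ∣ ℚ.+ δ
        ≤⟨ ℚP.+-monoˡ-≤ δ (ℚP.+-mono-≤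
             (ℚP.≤-trans (remainder≤ j n≤j) (ℚP.<⇒≤ (small n j N≤n n≤j)))
             (ℚP.≤-trans (leftSum-difference≤ j n≤j) (ℚP.<⇒≤ (small n j N≤n n≤j)))) ⟩
      δ ℚ.+ δ ℚ.+ δ
        ≡⟨ thirds ε ⟩
      ε ∎

≈-refl : ∀ x → x ≈ x
≈-refl x ε 0<ε = 0 , λ n _ → subst (ℚ._< ε) (sym (cong ℚ.∣_∣ (ℚP.+-inverseʳ (seq x n)))) 0<ε

mainTheorem4 : (p : ℕ) → p ℕ.≥ 1 → (x : ℝ) →
    ∃[ s ] ∃[ t ]
    HasSumFrom 2 (λ n → (∑[ k ∈ 1 ⋯ n ℕ.∸ 1 ] (fromℕ k ^ p)) * ((x ^ n) /! n)) s ×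
    HasSumFrom 1 (λ n → (fromℕ n ^ p) * (exp x - (∑[ k ∈ 0 ⋯ n ] ((x ^ k) /! k)))) t ×
    s ≈ t
mainTheorem4 p _ x =
  leftLimit p x , leftLimit p x , leftSum-converges p x , rightSum-converges p x , ≈-refl (leftLimit p x)
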